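{- Let $\mathcal{D}$ be a (possibly infinite) strong digraph. Then the infimum of $\ell(\gamma)\bigl(1-\lambda_S(\gamma)\bigr)$ taken over all proper cycles $\gamma$ of $\mathcal{D}$ is positive on $\mathcal{S}(\mathcal{D})$ if and only if $\mathcal{D}$ admits a finite cycle transversal: $$\inf_{\gamma\subset\mathcal{D}}\ \ell(\gamma)\bigl(1-\lambda_S(\gamma)\bigr)>0\quad \forall\, S\in\mathcal{S}(\mathcal{D})\iff |sct(\mathcal{D})|<\infty.$$
   Context: Digraphs have vertex-set $V(\mathcal{D})$ and arc-set $A(\mathcal{D})$, may be infinite, may have loops, but have no multiple arcs. A digraph is strong (strongly connected) if for any pair of distinct vertices $v,w$ there is a path from $v$ to $w$; each vertex of a strong digraph has at least one arc leaving it. A directed cycle is a finite strong digraph in which exactly one arc leaves each vertex (a loop is a cycle of length 1, an undirected edge, i.e. a pair of opposite arcs, is a cycle of length 2); "cycle" always means directed cycle, and $\ell(\gamma)$, the length of $\gamma$, is its number of arcs. A cycle $\gamma$ of $\mathcal{D}$ is proper, written $\gamma\subset\mathcal{D}$, if $\ell(\gamma)<|A(\mathcal{D})|$. A cycle transversal of $\mathcal{D}$ is a set of vertices whose removal (together with all incident arcs) leaves a digraph with no cycles; $|sct(\mathcal{D})|$ is the size of a smallest cycle transversal, and $|sct(\mathcal{D})|=\infty$ if there is no finite one. A weighting of $\mathcal{D}$ is a positive function on its arcs. It is substochastic if for each vertex the sum of the weights of the arcs leaving it (its out-weight) is not greater than $1$. $\mathcal{S}(\mathcal{D})$ is the class of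 all substochastic weightings of $\mathcal{D}$. For $S\in\mathcal{S}(\mathcal{D})$ and a cycle $\gamma$ of $\mathcal{D}$, $\lambda_S(\gamma)$ is the spectral radius (Perron root) of the weighted adjacency matrix of $\gamma$ weighted by $S$; it equals $S(\gamma)^{1/\ell(\gamma)}$, where $S(\gamma)$ is the product of the weights of the arcs of $\gamma$.
   Formalization: The digraph is assumed to admit at least one substochastic weighting; without this the claim fails, e.g. for the complete digraph on an uncountable vertex set, which has no substochastic weighting and no finite cycle transversal. -}

module Defs where

open import Algebra.Bundles using (CommutativeRing)
import Algebra.Properties.Monoid.Mult as Mult
import Algebra.Properties.Semiring.Sum as Sum
open import Data.Fin.Base using (Fin)
import Data.Fin.Properties as Fin
open import Data.List.Base using (List)
open import Data.List.Membership.Propositional using (_∈_)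
open import Data.Nat.Base using (ℕ; suc; NonZero)
open import Data.Product using (Σ-syntax; ∃; ∃!; ∃₂; ∃-syntax; _×_; _,_; proj₁; proj₂)
open import Data.Product.Properties using (Σ-≡,≡→≡)
open import Data.Refinement.Base using (Refinement; value)
open import Data.Vec.Functional using (Vector)
open import Function.Base using (_∘_; flip)
open import Function.Bundles using (_↣_; _↔_; mk↔ₛ′)
open import Function.Definitions using (Injective)
open import Level using (Level; 0ℓ; _⊔_) renaming (suc to lsuc)
open import Relation.Binary.Construct.Closure.ReflexiveTransitive using (Star)
import Relation.Binary.Construct.Add.Supremum.NonStrict as AddSup
import Relation.Binary.Construct.Add.Supremum.Strict as AddSupStrict
import Relation.Binary.Construct.NonStrictToStrict as ToStrict
open import Relation.Binary.Core using (Rel)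
open import Relation.Binary.Definitions using (Irrelevant; Decidable)
open import Relation.Binary.PropositionalEquality.Core
  using (_≡_; _≢_; refl; cong; subst)
open import Relation.Binary.Structures using (IsTotalOrder)
open import Relation.Nullary.Construct.Add.Supremum using (_⁺; [_])
open import Relation.Nullary.Decidable.Core using (Dec; yes; no; map′)
open import Relation.Nullary.Negation.Core using (¬_)
open import Relation.Unary using (Pred; ∁; Satisfiable)

private
  variable
    a ℓ p v : Level
    A : Set a
    V : Set v
    n : ℕ

------------------------------------------------------------------------
-- Bounds

IsUpperBound : Rel A ℓ → Pred A p → A → Set _
IsUpperBound _≤_ P u = ∀ {x} → P x → x ≤ u

IsSupremum IsInfimum IsMaximum : Rel A ℓ → Pred A p → A → Set _
IsSupremum _≤_ P s = IsUpperBound _≤_ P s × (∀ {u} → IsUpperBound _≤_ P u → s ≤ u)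
IsInfimum  _≤_     = IsSupremum (flip _≤_)
IsMaximum  _≤_ P m = P m × IsUpperBound _≤_ P m

------------------------------------------------------------------------
-- The real numbers, characterised (uniquely up to isomorphism, over a
-- classical metatheory) as a Dedekind-complete ordered field. Completeness
-- is only asked of predicates in the lowest universe; given excluded
-- middle it then holds for predicates in every universe.

record CompleteOrderedField : Set₁ where
  infix 4 _≤_
  field
    commutativeRing : CommutativeRing 0ℓ 0ℓ

  open CommutativeRing commutativeRing public

  field
    1≉0          : 1# ≉ 0#
    inverse      : ∀ {x} → x ≉ 0# → ∃[ y ] x * y ≈ 1#
    _≤_          : Rel Carrier 0ℓ
    isTotalOrder : IsTotalOrder _≈_ _≤_
    +-monoˡ-≤    : ∀ z {x y} → x ≤ y → x + z ≤ y + z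
    *-nonneg     : ∀ {x y} → 0# ≤ x → 0# ≤ y → 0# ≤ x * y
    complete     : (P : Pred Carrier 0ℓ) → Satisfiable P → Satisfiable (IsUpperBound _≤_ P) →
                   Satisfiable (IsSupremum _≤_ P)

  open ToStrict _≈_ _≤_ public using (_<_)
  open Sum semiring public using (sum)
  open Mult +-monoid public using () renaming (_×_ to _·_)

  fromℕ : ℕ → Carrier
  fromℕ k = k · 1#

  -- ℝ ∪ {+∞}
  open AddSup _≤_ public using (_≤⁺_)
  open AddSupStrict _<_ public using (_<⁺_)

------------------------------------------------------------------------
-- Complex numbers and the spectral radius of a real square matrix

module _ (ℝ : CompleteOrderedField) where
  open CompleteOrderedField ℝ

  record Complex : Set where
    constructor _+i_
    field
      re im : Carrier

  open Complex

  _≈ᶜ_ : Rel Complex 0ℓ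
  z ≈ᶜ w = re z ≈ re w × im z ≈ im w

  0ᶜ : Complex
  0ᶜ = 0# +i 0#

  ofReal : Carrier → Complex
  ofReal r = r +i 0#

  _*ᶜ_ : Complex → Complex → Complex
  (a +i b) *ᶜ (c +i d) = (a * c - b * d) +i (a * d + b * c)

  sumᶜ : Vector Complex n → Complex
  sumᶜ z = sum (re ∘ z) +i sum (im ∘ z)

  IsModulus : Complex → Carrier → Set
  IsModulus z r = 0# ≤ r × r * r ≈ re z * re z + im z * im z

  IsEigenvalue : (Fin n → Fin n → Carrier) → Complex → Set
  IsEigenvalue {n} M μ = Σ[ x ∈ Vector Complex n ]
    (¬ (∀ i → x i ≈ᶜ 0ᶜ)) × (∀ i → sumᶜ (λ j → ofReal (M i j) *ᶜ x j) ≈ᶜ (μ *ᶜ x i))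

  IsSpectralRadius : (Fin n → Fin n → Carrier) → Carrier → Set
  IsSpectralRadius M = IsMaximum _≤_ (λ r → ∃[ μ ] IsEigenvalue M μ × IsModulus μ r)

------------------------------------------------------------------------
-- Digraphs

-- Irrelevance of the arc relation says that there are no multiple arcs.
record Digraph (V : Set v) (a : Level) : Set (v ⊔ lsuc a) where
  infix 4 _⟶_
  field
    _⟶_        : Rel V a
    irrelevant : Irrelevant _⟶_

Arc : {V : Set v} → Digraph V a → Set (v ⊔ a)
Arc D = ∃₂ _⟶_
  where open Digraph D

OutArc : {V : Set v} → Digraph V a → V → Set (v ⊔ a)
OutArc D x = ∃ (x ⟶_)
  where open Digraph D

record IsStrong {V : Set v} (D : Digraph V a) : Set (v ⊔ a) where
  open Digraph D
  field
    connected : ∀ {x y} → x ≢ y → Star _⟶_ x y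
    leaves    : ∀ x → OutArc D x

record IsDirectedCycle {n : ℕ} (Γ : Digraph (Fin n) a) : Set a where
  open Digraph Γ
  field
    nonEmpty  : NonZero n
    isStrong  : IsStrong Γ
    uniqueArc : ∀ i → ∃! _≡_ (i ⟶_)

  next : Fin n → Fin n
  next i = proj₁ (uniqueArc i)

  _⟶?_ : Decidable _⟶_
  i ⟶? j = map′ (λ eq → subst (i ⟶_) eq (proj₁ (proj₂ (uniqueArc i))))
                (proj₂ (proj₂ (uniqueArc i))) (next i Fin.≟ j)

  -- A directed cycle has as many arcs as vertices.
  Arc↔Fin : Arc Γ ↔ Fin n
  Arc↔Fin = mk↔ₛ′ proj₁ (λ i → i , next i , proj₁ (proj₂ (uniqueArc i))) (λ _ → refl)
    λ (i , _ , e) → cong (i ,_) (Σ-≡,≡→≡ (proj₂ (proj₂ (uniqueArc i)) e , irrelevant _ _))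

-- A cycle of D is a directed cycle embedded in D. Its vertices are labelled
-- by Fin length, so that each cycle occurs once for every labelling.
record Cycle {V : Set v} (D : Digraph V a) : Set (v ⊔ a ⊔ lsuc 0ℓ) where
  open Digraph D using () renaming (_⟶_ to _⟶ᴰ_)
  field
    length           : ℕ
    Γ                : Digraph (Fin length) 0ℓ
    isDirectedCycle  : IsDirectedCycle Γ
    vertex           : Fin length → V
    vertex-injective : Injective _≡_ _≡_ vertex

  open Digraph Γ public
  open IsDirectedCycle isDirectedCycle public

  field
    arc : ∀ {i j} → i ⟶ j → vertex i ⟶ᴰ vertex j

-- length γ < |A(D)|, where |A(D)| may be infinite.
IsProper : {V : Set v} {D : Digraph V a} → Cycle D → Set (v ⊔ a)
IsProper {D = D} γ = Fin (suc (Cycle.length γ)) ↣ Arc D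

------------------------------------------------------------------------
-- Cycle transversals

-- Refinement keeps the proof of non-membership irrelevant, so that the
-- remaining vertices are equal as soon as they are equal in V.
_∖_ : {V : Set v} → Digraph V a → (T : Pred V p) → Digraph (Refinement V (∁ T)) a
D ∖ T = record
  { _⟶_        = λ x y → value x ⟶ value y
  ; irrelevant = irrelevant
  } where open Digraph D

IsCycleTransversal : {V : Set v} → Digraph V a → Pred V p → Set _
IsCycleTransversal D T = ¬ Cycle (D ∖ T)

HasFiniteCycleTransversal : {V : Set v} → Digraph V a → Set _
HasFiniteCycleTransversal {V = V} D = Σ[ T ∈ List V ] IsCycleTransversal D (_∈ T)

------------------------------------------------------------------------
-- Weightings

module _ (ℝ : CompleteOrderedField) {V : Set v} (D : Digraph V a) where
  open CompleteOrderedField ℝ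
  open Digraph D

  record Weighting : Set (v ⊔ a) where
    field
      weight   : ∀ {x y} → x ⟶ y → Carrier
      positive : ∀ {x y} (e : x ⟶ y) → 0# < weight e

module _ {ℝ : CompleteOrderedField} {V : Set v} {D : Digraph V a} (W : Weighting ℝ D) where
  open CompleteOrderedField ℝ
  open Digraph D
  open Weighting W

  -- The sums of the weights of finitely many distinct arcs leaving x.
  PartialOutSum : V → Pred Carrier (v ⊔ a)
  PartialOutSum x s = ∃[ k ] Σ[ f ∈ (Fin k → OutArc D x) ]
    Injective _≡_ _≡_ f × s ≈ sum (λ i → weight (proj₂ (f i)))

  -- Weights are positive, so a (possibly infinite) sum of them is the
  -- supremum of its finite partial sums.
  IsOutWeight : V → Carrier → Set (v ⊔ a)
  IsOutWeight x = IsSupremum _≤_ (PartialOutSum x)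

  IsSubstochastic : Set (v ⊔ a)
  IsSubstochastic = ∀ x → ∃[ s ] IsOutWeight x s × s ≤ 1#

  cycleMatrix : (γ : Cycle D) → Fin (Cycle.length γ) → Fin (Cycle.length γ) → Carrier
  cycleMatrix γ i j = entry (i ⟶γ? j)
    where
    open Cycle γ using (vertex; arc) renaming (_⟶_ to _⟶γ_; _⟶?_ to _⟶γ?_)

    entry : ∀ {i j} → Dec (i ⟶γ j) → Carrier
    entry (yes e) = weight (arc e)
    entry (no  _) = 0#

  -- The set of the ℓ(γ)(1 − λ(γ)) for γ a proper cycle of D.
  ProperCycleValue : Pred (Carrier ⁺) (v ⊔ a ⊔ lsuc 0ℓ)
  ProperCycleValue x = Σ[ γ ∈ Cycle D ] IsProper γ ×
    (Σ[ λγ ∈ Carrier ] IsSpectralRadius ℝ (cycleMatrix γ) λγ ×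
      x ≡ [ fromℕ (Cycle.length γ) * (1# - λγ) ])

  -- Taken in ℝ ∪ {+∞}, where the infimum of the empty set is +∞.
  HasPositiveInfimum : Set (v ⊔ a ⊔ lsuc 0ℓ)
  HasPositiveInfimum = ∃[ m ] IsInfimum _≤⁺_ ProperCycleValue m × [ 0# ] <⁺ m

𝒮 : (ℝ : CompleteOrderedField) {V : Set v} → Digraph V a → Set (v ⊔ a)
𝒮 ℝ D = Σ[ W ∈ Weighting ℝ D ] IsSubstochastic W

{-# OPTIONS --safe #-}

module Submission where

open import Defs
open import Axiom.ExcludedMiddle using (ExcludedMiddle)
import Algebra.Properties.AbelianGroup as AbelianGroupProperties
import Algebra.Properties.CommutativeMonoid.Sum as CommutativeMonoidSum
import Algebra.Properties.CommutativeSemiring.Exp as Exp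
import Algebra.Properties.Ring as RingProperties
import Algebra.Properties.Semiring.Mult as Mult
import Algebra.Properties.Semiring.Sum as Sum
import Algebra.Solver.Ring.NaturalCoefficients.Default as SemiringSolver
open import Data.Empty using (⊥-elim-irr)
open import Data.Fin.Base using (Fin; zero; suc; punchIn)
open import Data.Fin.Permutation using (Permutation; permutation)
open import Data.Fin.Properties using (injective⇒≤; punchInᵢ≢i; punchIn-injective; punchOut-injective)
open import Data.Irrelevant using ([_])
open import Data.List.Base using (List; []; _++_; allFin; map; tabulate)
import Data.List.Extrema as Extrema
open import Data.List.Membership.Propositional using (_∈_)
open import Data.List.Membership.Propositional.Properties
  using (∈-allFin; ∈-map⁺; ∈-++⁺ˡ; ∈-++⁺ʳ; ∈-tabulate⁺)
import Data.List.Relation.Unary.All as All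
import Data.List.Relation.Unary.All.Properties as All
open import Data.Maybe.Base using (Maybe; just; nothing)
open import Data.Nat.Base using (ℕ; zero; suc; _≤′_; ≤′-refl; ≤′-step; NonZero)
open import Data.Nat.Properties using (1+n≰n; 1+n≢n; <-cmp; ≤⇒≤′)
open import Data.Product.Base using (Σ-syntax; ∃; ∃-syntax; _×_; _,_; proj₁; proj₂)
open import Data.Refinement.Base using (value; _,_)
open import Data.Refinement.Properties using (value-injective)
open import Data.Sum.Base using (_⊎_; inj₁; inj₂)
open import Data.Vec.Functional using (Vector; replicate; removeAt)
open import Function.Base using (_∘_)
open import Function.Bundles using (_⇔_; mk⇔; mk↣; Injection)
open import Function.Definitions using (Injective)
open import Level using (Level; 0ℓ; _⊔_)
open import Relation.Binary.Bundles using (TotalOrder)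
import Relation.Binary.Construct.Add.Supremum.NonStrict as NonStrict⁺
import Relation.Binary.Construct.Add.Supremum.Strict as Strict⁺
open import Relation.Binary.Construct.Closure.ReflexiveTransitive using (Star; ε; _◅_; _◅◅_)
open import Relation.Binary.Definitions using (tri<; tri≈; tri>)
open import Relation.Binary.PropositionalEquality.Core as ≡ using (_≡_; _≢_)
import Relation.Binary.Reasoning.PartialOrder as PosetReasoning
open import Relation.Binary.Structures using (IsTotalOrder)
open import Relation.Nullary.Construct.Add.Supremum using (_⁺; [_]; ⊤⁺)
open import Relation.Nullary.Decidable using (True; toWitness; fromWitness)
open import Relation.Nullary.Decidable.Core using (Dec; yes; no)
open import Relation.Nullary.Negation.Core using (¬_; contradiction)
open import Relation.Unary using (Pred; Satisfiable)

-- Excluded middle decides arbitrary types, so it also provides choice.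
--
-- If T is a finite transversal and some vertex has two outgoing arcs, then
-- from each t ∈ T the only way forward leads to such a branch vertex u(t),
-- which every cycle through t therefore visits. The arc followed at u(t) has
-- weight at most 1 − δ, as another arc leaves u(t), hence λ ^ ℓ ≤ 1 − δ and,
-- by Bernoulli's inequality, ℓ (1 − λ) ≥ 1 − λ ^ ℓ ≥ δ with the same δ > 0
-- for all cycles. Without branch vertices there are no proper cycles.
--
-- If there is no finite transversal, choose disjoint cycles γ₀, γ₁, … one
-- after the other. On γₖ move the weight 1 − εₖ onto every arc of the cycle
-- and scale the other outgoing arcs by εₖ; then λ(γₖ) = 1 − εₖ, and
-- ℓ(γₖ) εₖ tends to 0 for suitable εₖ.

-- Arithmetic, finite products and completeness in an ordered field

module OrderedFieldProperties (em : ∀ {ℓ} → ExcludedMiddle ℓ) (ℝ : CompleteOrderedField) where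
  open CompleteOrderedField ℝ public hiding (zero)
  open IsTotalOrder isTotalOrder public
    using (total; antisym) renaming (refl to ≤-refl; reflexive to ≤-reflexive; trans to ≤-trans)
  open RingProperties ring public using (-‿distribˡ-*; -‿distribʳ-*; [y-z]x≈yx-zx; -0#≈0#)
  open AbelianGroupProperties +-abelianGroup public
    using () renaming (⁻¹-involutive to -‿involutive; //-rightDividesˡ to x-y+y≈x; //-rightDividesʳ to x+y-y≈x)
  open Mult semiring public using (×-assoc-*)
  open Sum semiring public
    using (sum-remove; sum-cong-≋; sum-replicate-zero; *-distribˡ-sum)
  open CommutativeMonoidSum *-commutativeMonoid public using ()
    renaming ( sum to product; sum-remove to product-remove; sum-cong-≋ to product-cong
             ; sum-replicate to product-replicate; ∑-distrib-+ to product-distrib-*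
             ; sum-permute to product-permute)
  open Exp commutativeSemiring public using (_^_; ^-distrib-*)
  open SemiringSolver commutativeSemiring public using (solve; _:=_; _:+_; _:*_; con)

  ≤-totalOrder : TotalOrder 0ℓ 0ℓ 0ℓ
  ≤-totalOrder = record { isTotalOrder = isTotalOrder }

  module ≤-Reasoning = PosetReasoning (TotalOrder.poset ≤-totalOrder)
  open ≤-Reasoning

  private
    variable
      n : ℕ
      p : Level
      x y z w : Carrier

  +-monoʳ-≤ : ∀ z → x ≤ y → z + x ≤ z + y
  +-monoʳ-≤ {x} {y} z x≤y = begin
    z + x ≈⟨ +-comm z x ⟩
    x + z ≤⟨ +-monoˡ-≤ z x≤y ⟩
    y + z ≈⟨ +-comm y z ⟩
    z + y ∎

  +-mono-≤ : x ≤ y → z ≤ w → x + z ≤ y + w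
  +-mono-≤ x≤y z≤w = ≤-trans (+-monoˡ-≤ _ x≤y) (+-monoʳ-≤ _ z≤w)

  +-cancelʳ-≤ : ∀ z → x + z ≤ y + z → x ≤ y
  +-cancelʳ-≤ {x} {y} z x+z≤y+z = begin
    x          ≈⟨ x+y-y≈x z x ⟨
    x + z - z  ≤⟨ +-monoˡ-≤ (- z) x+z≤y+z ⟩
    y + z - z  ≈⟨ x+y-y≈x z y ⟩
    y          ∎

  x+y≤z⇒x≤z-y : x + y ≤ z → x ≤ z - y
  x+y≤z⇒x≤z-y {y = y} {z} x+y≤z = +-cancelʳ-≤ y (≤-trans x+y≤z (≤-reflexive (sym (x-y+y≈x y z))))

  x≤y⇒0≤y-x : x ≤ y → 0# ≤ y - x
  x≤y⇒0≤y-x {x} {y} x≤y = x+y≤z⇒x≤z-y (≤-trans (≤-reflexive (+-identityˡ x)) x≤y)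

  0≤y-x⇒x≤y : 0# ≤ y - x → x ≤ y
  0≤y-x⇒x≤y {y} {x} 0≤y-x = begin
    x          ≈⟨ +-identityˡ x ⟨
    0# + x     ≤⟨ +-monoˡ-≤ x 0≤y-x ⟩
    y - x + x  ≈⟨ x-y+y≈x x y ⟩
    y          ∎

  -‿anti-≤ : x ≤ y → - y ≤ - x
  -‿anti-≤ {x} {y} x≤y = 0≤y-x⇒x≤y (begin
    0#           ≤⟨ x≤y⇒0≤y-x x≤y ⟩
    y - x        ≈⟨ +-comm y (- x) ⟩
    - x + y      ≈⟨ +-congˡ (-‿involutive y) ⟨
    - x - (- y)  ∎)

  *-monoˡ-≤ : 0# ≤ z → x ≤ y → x * z ≤ y * z
  *-monoˡ-≤ {z} {x} {y} 0≤z x≤y = 0≤y-x⇒x≤y (begin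
    0#             ≤⟨ *-nonneg (x≤y⇒0≤y-x x≤y) 0≤z ⟩
    (y - x) * z    ≈⟨ [y-z]x≈yx-zx z y x ⟩
    y * z - x * z  ∎)

  *-monoʳ-≤ : 0# ≤ z → x ≤ y → z * x ≤ z * y
  *-monoʳ-≤ {z} {x} {y} 0≤z x≤y = begin
    z * x ≈⟨ *-comm z x ⟩
    x * z ≤⟨ *-monoˡ-≤ 0≤z x≤y ⟩
    y * z ≈⟨ *-comm y z ⟩
    z * y ∎

  *-mono-≤ : 0# ≤ x → 0# ≤ w → x ≤ y → z ≤ w → x * z ≤ y * w
  *-mono-≤ 0≤x 0≤w x≤y z≤w = ≤-trans (*-monoʳ-≤ 0≤x z≤w) (*-monoˡ-≤ 0≤w x≤y)

  *-cancelʳ-≈ : z ≉ 0# → x * z ≈ y * z → x ≈ y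
  *-cancelʳ-≈ {z} {x} {y} z≉0 xz≈yz with z⁻¹ , zz⁻¹≈1 ← inverse z≉0 = begin-equality
    x              ≈⟨ *-identityʳ x ⟨
    x * 1#         ≈⟨ *-congˡ zz⁻¹≈1 ⟨
    x * (z * z⁻¹)  ≈⟨ *-assoc x z z⁻¹ ⟨
    x * z * z⁻¹    ≈⟨ *-congʳ xz≈yz ⟩
    y * z * z⁻¹    ≈⟨ *-assoc y z z⁻¹ ⟩
    y * (z * z⁻¹)  ≈⟨ *-congˡ zz⁻¹≈1 ⟩
    y * 1#         ≈⟨ *-identityʳ y ⟩
    y              ∎

  *-cancelʳ-≤ : 0# < z → x * z ≤ y * z → x ≤ y
  *-cancelʳ-≤ {x = x} {y} (0≤z , 0≉z) xz≤yz with total x y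
  ... | inj₁ x≤y = x≤y
  ... | inj₂ y≤x = ≤-reflexive (*-cancelʳ-≈ (0≉z ∘ sym) (antisym xz≤yz (*-monoˡ-≤ 0≤z y≤x)))

  x*y≈0⇒x≈0 : y ≉ 0# → x * y ≈ 0# → x ≈ 0#
  x*y≈0⇒x≈0 {y} y≉0 xy≈0 = *-cancelʳ-≈ y≉0 (trans xy≈0 (sym (zeroˡ y)))

  *-pos : 0# < x → 0# < y → 0# < x * y
  *-pos (0≤x , 0≉x) (0≤y , 0≉y) =
    *-nonneg 0≤x 0≤y , λ 0≈xy → 0≉x (sym (x*y≈0⇒x≈0 (0≉y ∘ sym) (sym 0≈xy)))

  x-0*y≈x : ∀ x y → x - 0# * y ≈ x
  x-0*y≈x x y = trans (+-congˡ (trans (-‿cong (zeroˡ y)) -0#≈0#)) (+-identityʳ x)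

  x+0*y≈x : ∀ x y → x + 0# * y ≈ x
  x+0*y≈x x y = trans (+-congˡ (zeroˡ y)) (+-identityʳ x)

  +-nonneg : 0# ≤ x → 0# ≤ y → 0# ≤ x + y
  +-nonneg 0≤x 0≤y = ≤-trans (≤-reflexive (sym (+-identityˡ 0#))) (+-mono-≤ 0≤x 0≤y)

  x≤x+y : 0# ≤ y → x ≤ x + y
  x≤x+y {y} {x} 0≤y = ≤-trans (≤-reflexive (sym (+-identityʳ x))) (+-monoʳ-≤ x 0≤y)

  <-≤-trans : x < y → y ≤ z → x < z
  <-≤-trans x<y y≤z = begin-strict _ <⟨ x<y ⟩ _ ≤⟨ y≤z ⟩ _ ∎

  +-pos-nonneg : 0# < x → 0# ≤ y → 0# < x + y
  +-pos-nonneg 0<x 0≤y = <-≤-trans 0<x (x≤x+y 0≤y)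

  -x*-x≈x*x : ∀ x → - x * - x ≈ x * x
  -x*-x≈x*x x = begin-equality
    - x * - x    ≈⟨ -‿distribˡ-* x (- x) ⟨
    - (x * - x)  ≈⟨ -‿cong (-‿distribʳ-* x x) ⟨
    - - (x * x)  ≈⟨ -‿involutive (x * x) ⟩
    x * x        ∎

  square-nonneg : ∀ x → 0# ≤ x * x
  square-nonneg x with total 0# x
  ... | inj₁ 0≤x = *-nonneg 0≤x 0≤x
  ... | inj₂ x≤0 = begin
    0#         ≤⟨ *-nonneg 0≤-x 0≤-x ⟩
    - x * - x  ≈⟨ -x*-x≈x*x x ⟩
    x * x      ∎
    where
    0≤-x : 0# ≤ - x
    0≤-x = ≤-trans (≤-reflexive (sym -0#≈0#)) (-‿anti-≤ x≤0)

  0≤1 : 0# ≤ 1#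
  0≤1 = ≤-trans (square-nonneg 1#) (≤-reflexive (*-identityˡ 1#))

  0<1 : 0# < 1#
  0<1 = 0≤1 , 1≉0 ∘ sym

  square≈0⇒≈0 : x * x ≈ 0# → x ≈ 0#
  square≈0⇒≈0 {x} xx≈0 with em {P = x ≈ 0#}
  ... | yes x≈0 = x≈0
  ... | no  x≉0 = x*y≈0⇒x≈0 x≉0 xx≈0

  +≈0⇒≈0 : 0# ≤ x → 0# ≤ y → x + y ≈ 0# → x ≈ 0#
  +≈0⇒≈0 0≤x 0≤y x+y≈0 = antisym (≤-trans (x≤x+y 0≤y) (≤-reflexive x+y≈0)) 0≤x

  -- Moduli of eigenvalues are specified through their squares, so estimates are made on squares and
  -- brought back here; no square root is ever formed.
  square-cancel-≤ : 0# ≤ x → 0# ≤ y → x * x ≤ y * y → x ≤ y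
  square-cancel-≤ {x} {y} 0≤x 0≤y xx≤yy with total x y | em {P = 0# ≈ x}
  ... | inj₁ x≤y | _       = x≤y
  ... | inj₂ y≤x | yes 0≈x = ≤-trans (≤-reflexive (sym 0≈x)) 0≤y
  ... | inj₂ y≤x | no  0≉x = *-cancelʳ-≤ (0≤x , 0≉x) (≤-trans xx≤yy (*-monoʳ-≤ 0≤y y≤x))

  ·-monoʳ-≤ : ∀ n → x ≤ y → n · x ≤ n · y
  ·-monoʳ-≤ zero    x≤y = ≤-refl
  ·-monoʳ-≤ (suc n) x≤y = +-mono-≤ x≤y (·-monoʳ-≤ n x≤y)

  ·-nonneg : ∀ n → 0# ≤ x → 0# ≤ n · x
  ·-nonneg zero    0≤x = ≤-refl
  ·-nonneg (suc n) 0≤x = +-nonneg 0≤x (·-nonneg n 0≤x)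

  suc·-pos : ∀ n → 0# < x → 0# < suc n · x
  suc·-pos n 0<x = +-pos-nonneg 0<x (·-nonneg n (proj₁ 0<x))

  ^-nonneg : ∀ n → 0# ≤ x → 0# ≤ x ^ n
  ^-nonneg zero    0≤x = 0≤1
  ^-nonneg (suc n) 0≤x = *-nonneg 0≤x (^-nonneg n 0≤x)

  -- The induction multiplies the bound for n by x and then raises the factor x on the linear term
  -- to 1. The additive form lets `slack⇒lowerBound` replace the power by a larger weight and cancel
  -- that weight.
  bernoulli : ∀ n → 0# ≤ x → x ≤ 1# → 1# ≤ x ^ n + fromℕ n * (1# - x)
  bernoulli {x} zero    0≤x x≤1 = x≤x+y (*-nonneg ≤-refl (x≤y⇒0≤y-x x≤1))
  bernoulli {x} (suc n) 0≤x x≤1 = begin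
    1#                                     ≈⟨ x-y+y≈x x 1# ⟨
    1-x + x                                ≈⟨ +-congˡ (*-identityʳ x) ⟨
    1-x + x * 1#                           ≤⟨ +-monoʳ-≤ 1-x (*-monoʳ-≤ 0≤x (bernoulli n 0≤x x≤1)) ⟩
    1-x + x * (x ^ n + fromℕ n * 1-x)      ≈⟨ +-congˡ (distribˡ x _ _) ⟩
    1-x + (x ^ suc n + x * (fromℕ n * 1-x))
      ≤⟨ +-monoʳ-≤ 1-x (+-monoʳ-≤ _ (*-monoˡ-≤ (*-nonneg (·-nonneg n 0≤1) (x≤y⇒0≤y-x x≤1)) x≤1)) ⟩
    1-x + (x ^ suc n + 1# * (fromℕ n * 1-x))
      ≈⟨ solve 3 (λ d p m → d :+ (p :+ con 1 :* (m :* d)) := p :+ (con 1 :+ m) :* d) refl 1-x (x ^ suc n) (fromℕ n) ⟩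
    x ^ suc n + fromℕ (suc n) * 1-x        ∎
    where
    1-x : Carrier
    1-x = 1# - x

  -- Excluded middle shrinks a predicate of any level to the lowest one.
  supremum : (P : Pred Carrier p) → Satisfiable P → Satisfiable (IsUpperBound _≤_ P) →
             Satisfiable (IsSupremum _≤_ P)
  supremum P (x , Px) (u , P≤u) = s , (λ Py → Q≤s (fromWitness Py)) , (λ P≤v → s≤ (λ Qy → P≤v (toWitness Qy)))
    where
    sup = complete (λ x → True (em {P = P x})) (x , fromWitness Px) (u , λ Qy → P≤u (toWitness Qy))
    s = proj₁ sup
    Q≤s = proj₁ (proj₂ sup)
    s≤ = proj₂ (proj₂ sup)

  -- If s is the supremum of the multiples of r, then s - r bounds them too, since adding r to a
  -- multiple gives another one. Hence s ≤ s - r.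
  archimedean : ∀ r b → (∀ n → n · r ≤ b) → r ≤ 0#
  archimedean r b bounded
    with s , multiples≤s , s≤ ← complete (λ x → ∃[ n ] x ≈ n · r) (0# , 0 , refl)
                             (b , λ (n , x≈n·r) → ≤-trans (≤-reflexive x≈n·r) (bounded n))
    = +-cancelʳ-≤ s (begin
      r + s        ≤⟨ +-monoʳ-≤ r (s≤ λ {x} (n , x≈n·r) → x+y≤z⇒x≤z-y (begin
        x + r      ≈⟨ trans (+-comm x r) (+-congˡ x≈n·r) ⟩
        suc n · r  ≤⟨ multiples≤s (suc n , refl) ⟩
        s          ∎)) ⟩
      r + (s - r)  ≈⟨ trans (+-comm r _) (x-y+y≈x r s) ⟩
      s            ≈⟨ +-identityˡ s ⟨
      0# + s       ∎)

  product-nonneg : (f : Vector Carrier n) → (∀ i → 0# ≤ f i) → 0# ≤ product f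
  product-nonneg {zero}  f 0≤f = 0≤1
  product-nonneg {suc n} f 0≤f = *-nonneg (0≤f zero) (product-nonneg (f ∘ suc) (0≤f ∘ suc))

  product-pos : (f : Vector Carrier n) → (∀ i → 0# < f i) → 0# < product f
  product-pos {zero}  f 0<f = 0<1
  product-pos {suc n} f 0<f = *-pos (0<f zero) (product-pos (f ∘ suc) (0<f ∘ suc))

  product≤1 : (f : Vector Carrier n) → (∀ i → 0# ≤ f i) → (∀ i → f i ≤ 1#) → product f ≤ 1#
  product≤1 {zero}  f 0≤f f≤1 = ≤-refl
  product≤1 {suc n} f 0≤f f≤1 = ≤-trans
    (*-mono-≤ (0≤f zero) 0≤1 (f≤1 zero) (product≤1 (f ∘ suc) (0≤f ∘ suc) (f≤1 ∘ suc)))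
    (≤-reflexive (*-identityˡ 1#))

  product≤factor : (f : Vector Carrier n) → (∀ i → 0# ≤ f i) → (∀ i → f i ≤ 1#) → ∀ i → product f ≤ f i
  product≤factor {suc n} f 0≤f f≤1 i = begin
    product f                   ≈⟨ product-remove {i = i} f ⟩
    f i * product (removeAt f i) ≤⟨ *-monoʳ-≤ (0≤f i) (product≤1 _ (0≤f ∘ punchIn i) (f≤1 ∘ punchIn i)) ⟩
    f i * 1#                    ≈⟨ *-identityʳ (f i) ⟩
    f i                         ∎

  sum-single : (f : Vector Carrier n) → ∀ i → (∀ j → j ≢ i → f j ≈ 0#) → sum f ≈ f i
  sum-single {suc n} f i f≈0 = begin-equality
    sum f                    ≈⟨ sum-remove {i = i} f ⟩
    f i + sum (removeAt f i) ≈⟨ +-congˡ (sum-cong-≋ (λ j → f≈0 (punchIn i j) (punchInᵢ≢i i j))) ⟩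
    f i + sum (replicate n 0#) ≈⟨ +-congˡ (sum-replicate-zero n) ⟩
    f i + 0#                 ≈⟨ +-identityʳ (f i) ⟩
    f i                      ∎

-- Pigeonhole principle, strong connectivity and the successor permutation of a cycle

injective⇒¬misses : ∀ {n} {f : Fin n → Fin n} → Injective _≡_ _≡_ f → ∀ j → ¬ (∀ i → j ≢ f i)
injective⇒¬misses {suc n} {f} f-injective j j≢f =
  -- Punching out the missed value j would inject `Fin (suc n)` into `Fin n`.
  1+n≰n (injective⇒≤ λ {i} {i′} eq → f-injective (punchOut-injective (j≢f i) (j≢f i′) eq))

module _ {v a} (em : ∀ {ℓ} → ExcludedMiddle ℓ) {V : Set v} {D : Digraph V a} (strong : IsStrong D) where
  open Digraph D

  -- The form in which strong connectivity is used throughout: a property inherited along arcs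
  -- travels along paths. Equal endpoints are treated apart because `connected` only joins distinct
  -- vertices.
  outClosed⇒universal : ∀ {p} (P : Pred V p) → (∀ {x y} → x ⟶ y → P x → P y) → ∀ {x} → P x → ∀ y → P y
  outClosed⇒universal P closed {x} Px y with em {P = x ≡ y}
  ... | yes ≡.refl = Px
  ... | no  x≢y    = along (IsStrong.connected strong x≢y) Px
    where
    along : ∀ {x y} → Star _⟶_ x y → P x → P y
    along ε        Px = Px
    along (e ◅ es) Px = along es (closed e Px)

module DirectedCycleProperties (em : ∀ {ℓ} → ExcludedMiddle ℓ)
                               {n a} {Γ : Digraph (Fin n) a} (cyc : IsDirectedCycle Γ) where
  open Digraph Γ
  open IsDirectedCycle cyc

  nextArc : ∀ i → i ⟶ next i
  nextArc i = proj₁ (proj₂ (uniqueArc i))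

  next-unique : ∀ {i j} → i ⟶ j → next i ≡ j
  next-unique = proj₂ (proj₂ (uniqueArc _))

  base : Fin n
  base = first nonEmpty
    where
    first : ∀ {m} → NonZero m → Fin m
    first {suc _} _ = zero

  nextClosed⇒universal : ∀ {p} (P : Pred (Fin n) p) → (∀ i → P i → P (next i)) → ∀ {i} → P i → ∀ j → P j
  nextClosed⇒universal P closed = outClosed⇒universal em isStrong P
    (λ {i} e Pi → ≡.subst P (next-unique e) (closed i Pi))

  -- The image of `next` is closed under `next` and contains `next base`, so it is everything.
  next-surjective : ∀ j → ∃[ i ] next i ≡ j
  next-surjective = nextClosed⇒universal _ (λ i _ → i , ≡.refl) (base , ≡.refl)

  prev : Fin n → Fin n
  prev j = proj₁ (next-surjective j)

  next-prev : ∀ j → next (prev j) ≡ j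
  next-prev j = proj₂ (next-surjective j)

  -- Having the left inverse `next`, `prev` is injective; by finiteness it takes the value i, say at
  -- j, and then `next i` is j.
  prev-next : ∀ i → prev (next i) ≡ i
  prev-next i with em {P = ∃[ j ] i ≡ prev j}
  ... | yes (j , ≡.refl) = ≡.cong prev (next-prev j)
  ... | no  i∉prev       = contradiction (λ j i≡ → i∉prev (j , i≡)) (injective⇒¬misses prev-injective i)
    where
    prev-injective : Injective _≡_ _≡_ prev
    prev-injective {j} {j′} eq =
      ≡.trans (≡.sym (next-prev j)) (≡.trans (≡.cong next eq) (next-prev j′))

  nextPermutation : Permutation n n
  nextPermutation = permutation next prev next-prev prev-next

-- Eigenvalues and spectral radius of a weighted cycle

module _ (em : ∀ {ℓ} → ExcludedMiddle ℓ) (ℝ : CompleteOrderedField) where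
  open OrderedFieldProperties em ℝ
  open ≤-Reasoning
  open Complex

  normSq : Complex ℝ → Carrier
  normSq z = re z * re z + im z * im z

  normSq-nonneg : ∀ z → 0# ≤ normSq z
  normSq-nonneg z = +-nonneg (square-nonneg (re z)) (square-nonneg (im z))

  normSq-cong : ∀ {z w} → _≈ᶜ_ ℝ z w → normSq z ≈ normSq w
  normSq-cong (re≈ , im≈) = +-cong (*-cong re≈ re≈) (*-cong im≈ im≈)

  normSq≈0⇒≈0 : ∀ {z} → normSq z ≈ 0# → _≈ᶜ_ ℝ z (0ᶜ ℝ)
  normSq≈0⇒≈0 {z} N≈0 =
    square≈0⇒≈0 (+≈0⇒≈0 (square-nonneg (re z)) (square-nonneg (im z)) N≈0) ,
    square≈0⇒≈0 (+≈0⇒≈0 (square-nonneg (im z)) (square-nonneg (re z)) (trans (+-comm _ _) N≈0))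

  normSq-*ᶜ : ∀ z w → normSq (_*ᶜ_ ℝ z w) ≈ normSq z * normSq w
  normSq-*ᶜ (p +i q) (c +i d) = begin-equality
    (p * c - q * d) * (p * c - q * d) + (p * d + q * c) * (p * d + q * c)
      ≈⟨ +-congʳ (*-cong (+-congˡ (-‿distribˡ-* q d)) (+-congˡ (-‿distribˡ-* q d))) ⟩
    (p * c + - q * d) * (p * c + - q * d) + (p * d + q * c) * (p * d + q * c)
      -- The solver works in semirings, so `- q` enters as an independent variable `q⁻`; the cross
      -- terms collect in a multiple of `q - q`.
      ≈⟨ solve 5 (λ p q q⁻ c d →
           (p :* c :+ q⁻ :* d) :* (p :* c :+ q⁻ :* d) :+ (p :* d :+ q :* c) :* (p :* d :+ q :* c) :=
           (p :* p) :* (c :* c :+ d :* d) :+ (q :* q) :* (c :* c) :+ (q⁻ :* q⁻) :* (d :* d)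
             :+ (q :+ q⁻) :* (con 2 :* p :* c :* d)) refl p q (- q) c d ⟩
    p * p * N + q * q * (c * c) + - q * - q * (d * d) + (q - q) * _
      ≈⟨ +-cong (+-congˡ (*-congʳ (-x*-x≈x*x q))) (trans (*-congʳ (-‿inverseʳ q)) (zeroˡ _)) ⟩
    p * p * N + q * q * (c * c) + q * q * (d * d) + 0#
      ≈⟨ solve 4 (λ p q c d →
           (p :* p) :* (c :* c :+ d :* d) :+ (q :* q) :* (c :* c) :+ (q :* q) :* (d :* d) :+ con 0 :=
           (p :* p :+ q :* q) :* (c :* c :+ d :* d)) refl p q c d ⟩
    (p * p + q * q) * N ∎
    where
    N : Carrier
    N = c * c + d * d

  normSq-scale : ∀ w z → normSq ((w * re z) +i (w * im z)) ≈ w * w * normSq z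
  normSq-scale w (a +i b) =
    solve 3 (λ w a b → (w :* a) :* (w :* a) :+ (w :* b) :* (w :* b) := (w :* w) :* (a :* a :+ b :* b)) refl w a b

  module CycleMatrixProperties {v a} {V : Set v} {D : Digraph V a} (W : Weighting ℝ D) (γ : Cycle D) where
    open Weighting W
    open Cycle γ
    open DirectedCycleProperties em isDirectedCycle

    arcWeight : Fin length → Carrier
    arcWeight i = weight (arc (nextArc i))

    cycleMatrix-next : ∀ i → cycleMatrix W γ i (next i) ≡ arcWeight i
    cycleMatrix-next i with i ⟶? next i
    ... | yes e = ≡.cong (weight ∘ arc) (irrelevant e (nextArc i))
    ... | no ¬e = contradiction (nextArc i) ¬e

    cycleMatrix-other : ∀ i {j} → j ≢ next i → cycleMatrix W γ i j ≡ 0#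
    cycleMatrix-other i {j} j≢ with i ⟶? j
    ... | yes e = contradiction (≡.sym (next-unique e)) j≢
    ... | no ¬e = ≡.refl

    -- Row i has a single nonzero entry, in column `next i`, so the matrix shifts a vector along the
    -- cycle and rescales it.
    cycleMatrix-row : ∀ (x : Vector (Complex ℝ) length) i →
                      _≈ᶜ_ ℝ (sumᶜ ℝ (λ j → _*ᶜ_ ℝ (ofReal ℝ (cycleMatrix W γ i j)) (x j)))
                             ((arcWeight i * re (x (next i))) +i (arcWeight i * im (x (next i))))
    cycleMatrix-row x i = row _-_ (re ∘ x) (im ∘ x) x-0*y≈x , row _+_ (im ∘ x) (re ∘ x) x+0*y≈x
      where
      -- Serves both the real and the imaginary part: `_∙_` is the sign in the complex product, and
      -- its second term vanishes because matrix entries are real.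
      row : ∀ (_∙_ : Carrier → Carrier → Carrier) (f g : Fin length → Carrier) → (∀ y z → y ∙ (0# * z) ≈ y) →
            sum (λ j → (cycleMatrix W γ i j * f j) ∙ (0# * g j)) ≈ arcWeight i * f (next i)
      row _∙_ f g ∙-identityʳ = begin-equality
        sum (λ j → (cycleMatrix W γ i j * f j) ∙ (0# * g j))  ≈⟨ sum-cong-≋ (λ j → ∙-identityʳ _ (g j)) ⟩
        sum (λ j → cycleMatrix W γ i j * f j)                 ≈⟨ sum-single _ (next i) (λ j j≢ →
                                                                   trans (*-congʳ (reflexive (cycleMatrix-other i j≢))) (zeroˡ (f j))) ⟩
        cycleMatrix W γ i (next i) * f (next i)               ≈⟨ *-congʳ (reflexive (cycleMatrix-next i)) ⟩
        arcWeight i * f (next i)                              ∎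

    module _ {r} (eigenmodulus : ∃[ μ ] IsEigenvalue ℝ (cycleMatrix W γ) μ × IsModulus ℝ μ r) where

      private
        μ = proj₁ eigenmodulus
        x = proj₁ (proj₁ (proj₂ eigenmodulus))
        x≉0 = proj₁ (proj₂ (proj₁ (proj₂ eigenmodulus)))
        Mx≈μx = proj₂ (proj₂ (proj₁ (proj₂ eigenmodulus)))
        0≤r = proj₁ (proj₂ (proj₂ eigenmodulus))
        rr≈ = proj₂ (proj₂ (proj₂ eigenmodulus))

        N : Fin length → Carrier
        N i = normSq (x i)

      -- Squared moduli of row i of the eigenvalue equation: the complex problem becomes a
      -- recurrence of nonnegative reals around the cycle.
      normSq-step : ∀ i → r * r * N i ≈ arcWeight i * arcWeight i * N (next i)
      normSq-step i = begin-equality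
        r * r * N i                ≈⟨ *-congʳ rr≈ ⟩
        normSq μ * N i             ≈⟨ normSq-*ᶜ μ (x i) ⟨
        normSq (_*ᶜ_ ℝ μ (x i))    ≈⟨ normSq-cong (Mx≈μx i) ⟨
        normSq (sumᶜ ℝ (λ j → _*ᶜ_ ℝ (ofReal ℝ (cycleMatrix W γ i j)) (x j)))
                                   ≈⟨ normSq-cong (cycleMatrix-row x i) ⟩
        normSq ((arcWeight i * re (x (next i))) +i (arcWeight i * im (x (next i))))
                                   ≈⟨ normSq-scale (arcWeight i) (x (next i)) ⟩
        arcWeight i * arcWeight i * N (next i) ∎

      -- A zero of the eigenvector would propagate along the whole cycle.
      normSq-pos : ∀ i → 0# < N i
      normSq-pos i = normSq-nonneg (x i) , λ 0≈Nᵢ →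
        x≉0 (λ j → normSq≈0⇒≈0 (nextClosed⇒universal (λ k → N k ≈ 0#) zero-step (sym 0≈Nᵢ) j))
        where
        zero-step : ∀ k → N k ≈ 0# → N (next k) ≈ 0#
        zero-step k Nₖ≈0 = x*y≈0⇒x≈0 (proj₂ (*-pos 0<w 0<w) ∘ sym)
          (trans (*-comm _ _) (trans (sym (normSq-step k)) (trans (*-congˡ Nₖ≈0) (zeroʳ _))))
          where
          0<w : 0# < arcWeight k
          0<w = positive (arc (nextArc k))

      -- Look at an entry of the eigenvector of maximal modulus.
      modulus≤weightBound : ∀ {λ′} → (∀ i → arcWeight i ≤ λ′) → r ≤ λ′
      modulus≤weightBound {λ′} w≤λ′ = square-cancel-≤ 0≤r 0≤λ′ (*-cancelʳ-≤ (normSq-pos m) (begin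
        r * r * N m                            ≈⟨ normSq-step m ⟩
        arcWeight m * arcWeight m * N (next m)
          ≤⟨ *-mono-≤ (square-nonneg _) (normSq-nonneg _) (*-mono-≤ (0≤w m) 0≤λ′ (w≤λ′ m) (w≤λ′ m)) N≤Nₘ ⟩
        λ′ * λ′ * N m                          ∎))
        where
        open Extrema ≤-totalOrder

        m : Fin length
        m = argmax N base (allFin length)

        N≤Nₘ : N (next m) ≤ N m
        N≤Nₘ = All.lookup (f[xs]≤f[argmax] {f = N} base (allFin length)) (∈-allFin (next m))

        0≤w : ∀ i → 0# ≤ arcWeight i
        0≤w i = proj₁ (positive (arc (nextArc i)))

        0≤λ′ : 0# ≤ λ′
        0≤λ′ = ≤-trans (0≤w base) (w≤λ′ base)

      -- The entries cancel from the product of the equations normSq-step over the cycle.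
      modulus^length≤weight : (∀ i → arcWeight i ≤ 1#) → ∀ i → r ^ length ≤ arcWeight i
      modulus^length≤weight w≤1 i = square-cancel-≤ (^-nonneg length 0≤r) (0≤w i) (begin
        r ^ length * r ^ length  ≈⟨ ^-distrib-* r r length ⟨
        (r * r) ^ length         ≤⟨ *-cancelʳ-≤ (product-pos N normSq-pos) (≤-reflexive products) ⟩
        product w²               ≤⟨ product≤factor w² (λ j → square-nonneg _) w²≤1 i ⟩
        arcWeight i * arcWeight i ∎)
        where
        w² : Fin length → Carrier
        w² j = arcWeight j * arcWeight j

        0≤w : ∀ j → 0# ≤ arcWeight j
        0≤w j = proj₁ (positive (arc (nextArc j)))

        w²≤1 : ∀ j → w² j ≤ 1#
        w²≤1 j = ≤-trans (*-mono-≤ (0≤w j) 0≤1 (w≤1 j) (w≤1 j)) (≤-reflexive (*-identityˡ 1#))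

        products : (r * r) ^ length * product N ≈ product w² * product N
        products = begin-equality
          (r * r) ^ length * product N          ≈⟨ *-congʳ (product-replicate length) ⟨
          product (replicate length (r * r)) * product N ≈⟨ product-distrib-* (λ _ → r * r) N ⟨
          product (λ j → r * r * N j)           ≈⟨ product-cong normSq-step ⟩
          product (λ j → w² j * N (next j))     ≈⟨ product-distrib-* w² (N ∘ next) ⟩
          product w² * product (N ∘ next)       ≈⟨ *-congˡ (product-permute N nextPermutation) ⟨
          product w² * product N                ∎

    -- The all-ones vector is an eigenvector for `λ′`, so this modulus is attained, and
    -- `modulus≤weightBound` allows no larger one.
    constantWeight⇒spectralRadius : ∀ {λ′} → (∀ i → arcWeight i ≈ λ′) → IsSpectralRadius ℝ (cycleMatrix W γ) λ′
    constantWeight⇒spectralRadius {λ′} w≈λ′ =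
      (ofReal ℝ λ′ , ((λ _ → ofReal ℝ 1#) , (λ 1≈0 → 1≉0 (proj₁ (1≈0 base))) , eigen) , 0≤λ′ ,
        sym (x+0*y≈x _ 0#)) ,
      λ (_ , eigenmodulus) → modulus≤weightBound (_ , eigenmodulus) (≤-reflexive ∘ w≈λ′)
      where
      0≤λ′ : 0# ≤ λ′
      0≤λ′ = ≤-trans (proj₁ (positive (arc (nextArc base)))) (≤-reflexive (w≈λ′ base))

      eigen : ∀ i → _≈ᶜ_ ℝ (sumᶜ ℝ (λ j → _*ᶜ_ ℝ (ofReal ℝ (cycleMatrix W γ i j)) (ofReal ℝ 1#)))
                           (_*ᶜ_ ℝ (ofReal ℝ λ′) (ofReal ℝ 1#))
      eigen i with re≈ , im≈ ← cycleMatrix-row (λ _ → ofReal ℝ 1#) i =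
        trans re≈ (trans (*-congʳ (w≈λ′ i)) (sym (x-0*y≈x _ 0#))) ,
        trans im≈ (trans (*-congʳ (w≈λ′ i)) (sym (x+0*y≈x _ 1#)))

-- Cycles before and after deleting vertices

module _ {v a} {V : Set v} {D : Digraph V a} where

  outArc : (γ : Cycle D) → ∀ i → OutArc D (Cycle.vertex γ i)
  outArc γ i = vertex (next i) , arc (proj₁ (proj₂ (uniqueArc i)))
    where open Cycle γ

  Visits : Cycle D → Pred V v
  Visits γ x = ∃[ i ] Cycle.vertex γ i ≡ x

  unrestrict : ∀ {p} {T : Pred V p} → Cycle (D ∖ T) → Cycle D
  unrestrict γ = record
    { length           = length
    ; Γ                = Γ
    ; isDirectedCycle  = isDirectedCycle
    ; vertex           = value ∘ vertex
    ; vertex-injective = vertex-injective ∘ value-injective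
    ; arc              = arc
    } where open Cycle γ

  unrestrict-avoids : ∀ {p} {T : Pred V p} (γ : Cycle (D ∖ T)) → ∀ i → ¬ T (Cycle.vertex (unrestrict γ) i)
  unrestrict-avoids γ i v∈T with Cycle.vertex γ i
  -- Non-membership is stored irrelevantly, so it can only be consumed by an irrelevant elimination
  -- of falsity.
  ... | _ , [ v∉T ] = ⊥-elim-irr (v∉T v∈T)

  restrict : ∀ {p} {T : Pred V p} (γ : Cycle D) → (∀ i → ¬ T (Cycle.vertex γ i)) → Cycle (D ∖ T)
  restrict γ avoids = record
    { length           = length
    ; Γ                = Γ
    ; isDirectedCycle  = isDirectedCycle
    ; vertex           = λ i → vertex i , [ avoids i ]
    ; vertex-injective = vertex-injective ∘ ≡.cong value
    ; arc              = arc
    } where open Cycle γ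

-- Branch vertices and forced walks

module Branching (em : ∀ {ℓ} → ExcludedMiddle ℓ) {v a} {V : Set v} (D : Digraph V a) (strong : IsStrong D) where
  open Digraph D

  Branch : Pred V (v ⊔ a)
  Branch x = Σ[ e ∈ OutArc D x ] Σ[ e′ ∈ OutArc D x ] e ≢ e′

  nonbranching⇒≡ : ∀ {x} → ¬ Branch x → (e e′ : OutArc D x) → e ≡ e′
  nonbranching⇒≡ ¬branch e e′ with em {P = e ≡ e′}
  ... | yes e≡e′ = e≡e′
  ... | no  e≢e′ = contradiction (e , e′ , e≢e′) ¬branch

  -- Every arc leaving the cycle's vertex set would have to be an arc of the cycle, so the cycle
  -- visits all vertices. As one arc leaves each vertex, an arc of D is determined by the position
  -- of its source on the cycle.
  nonbranching⇒¬proper : (∀ x → ¬ Branch x) → (γ : Cycle D) → ¬ IsProper γ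
  nonbranching⇒¬proper ¬branch γ proper =
    1+n≰n (injective⇒≤ (Injection.injective proper ∘ index-injective))
    where
    open Cycle γ
    open DirectedCycleProperties em isDirectedCycle

    visits : ∀ x → Visits γ x
    visits = outClosed⇒universal em strong (Visits γ)
      (λ { {y = y} e (i , ≡.refl) → next i , ≡.cong proj₁ (nonbranching⇒≡ (¬branch _) (outArc γ i) (y , e)) })
      (base , ≡.refl)

    index : Arc D → Fin length
    index (x , _) = proj₁ (visits x)

    index-injective : Injective _≡_ _≡_ index
    index-injective {x , e} {x′ , e′} eq
      with ≡.refl ← ≡.trans (≡.sym (proj₂ (visits x))) (≡.trans (≡.cong vertex eq) (proj₂ (visits x′)))
      = ≡.cong (x ,_) (nonbranching⇒≡ (¬branch x) e e′)

  -- A cycle through x has no choice but to follow the only arc leaving x.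
  Forced : V → V → Set (v ⊔ a)
  Forced x y = x ⟶ y × ¬ Branch x

  forced⇒visits : ∀ {x y} (γ : Cycle D) → Star Forced x y → Visits γ x → Visits γ y
  forced⇒visits γ ε                              visit        = visit
  forced⇒visits γ (_◅_ {j = y} (e , ¬branch) es) (i , ≡.refl) =
    forced⇒visits γ es (Cycle.next γ i , ≡.cong proj₁ (nonbranching⇒≡ ¬branch (outArc γ i) (y , e)))

  -- If no forced walk from x met a branch vertex, the set of vertices it reaches would be closed
  -- under arcs, hence contain z, which is a branch vertex.
  forcedToBranch : ∃ Branch → ∀ x → ∃[ y ] Star Forced x y × Branch y
  forcedToBranch (z , branch) x with em {P = ∃[ y ] Star Forced x y × Branch y}
  ... | yes found = found
  ... | no  none  = contradiction (z , outClosed⇒universal em strong (Star Forced x) extend ε z , branch) none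
    where
    extend : ∀ {y y′} → y ⟶ y′ → Star Forced x y → Star Forced x y′
    extend {y} e x↝y = x↝y ◅◅ ((e , λ branch → none (y , x↝y , branch)) ◅ ε)

-- Positive infima in the extended reals

module _ (em : ∀ {ℓ} → ExcludedMiddle ℓ) (ℝ : CompleteOrderedField) where
  open OrderedFieldProperties em ℝ
  open ≤-Reasoning
  open NonStrict⁺ _≤_ using ([_]; _≤⊤⁺; [≤]-injective)
  open Strict⁺ _<_ using ([_]; [_]<⊤⁺)

  -- Completeness provides suprema, so the infimum is minus the supremum of the negated finite
  -- values. The uniform bound `b` keeps it away from 0.
  positiveInfimum : ∀ {p} (P : Pred (Carrier ⁺) p) {b} → 0# < b → (∀ {x} → P [ x ] → b ≤ x) →
                    ∃[ m ] IsInfimum _≤⁺_ P m × [ 0# ] <⁺ m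
  positiveInfimum P {b} 0<b b≤ with em {P = ∃[ x ] P [ x ]}
  ... | no none =
    ⊤⁺ , ((λ { {[ x ]} Px → contradiction (x , Px) none ; {⊤⁺} _ → ⊤⁺ ≤⊤⁺ }) , λ _ → _ ≤⊤⁺) , [ _ ]<⊤⁺
  ... | yes (x₀ , Px₀) = [ - s ] , (lower , greatest) , [ <-≤-trans 0<b (below-s b≤) ]
    where
    -P : Pred Carrier _
    -P y = ∃[ x ] P [ x ] × y ≈ - x

    -P≤ : ∀ {c} → (∀ {x} → P [ x ] → c ≤ x) → IsUpperBound _≤_ -P (- c)
    -P≤ c≤P (x , Px , y≈-x) = ≤-trans (≤-reflexive y≈-x) (-‿anti-≤ (c≤P Px))

    sup : Satisfiable (IsSupremum _≤_ -P)
    sup = supremum -P (- x₀ , x₀ , Px₀ , refl) (- b , -P≤ b≤)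

    s : Carrier
    s = proj₁ sup

    below-s : ∀ {c} → (∀ {x} → P [ x ] → c ≤ x) → c ≤ - s
    below-s c≤P = ≤-trans (≤-reflexive (sym (-‿involutive _))) (-‿anti-≤ (proj₂ (proj₂ sup) (-P≤ c≤P)))

    lower : ∀ {y} → P y → [ - s ] ≤⁺ y
    lower {[ x ]} Px = [ ≤-trans (-‿anti-≤ (proj₁ (proj₂ sup) (x , Px , refl))) (≤-reflexive (-‿involutive x)) ]
    lower {⊤⁺}    _  = _ ≤⊤⁺

    greatest : ∀ {u} → (∀ {y} → P y → u ≤⁺ y) → u ≤⁺ [ - s ]
    greatest {[ u ]} u≤P = [ below-s (λ Px → [≤]-injective (u≤P Px)) ]
    greatest {⊤⁺}    ⊤≤P = contradiction (⊤≤P Px₀) λ ()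

  -- Substochastic weightings and slack at a vertex

  module _ {v a} {V : Set v} {D : Digraph V a} (W : Weighting ℝ D) where
    open Weighting W

    outWeight : ∀ {x} → OutArc D x → Carrier
    outWeight (_ , e) = weight e

    -- A reformulation of `IsSubstochastic` without suprema; the next two lemmas pass between them,
    -- so that all estimates concern finite sums.
    FinitePartialSums≤1 : Set (v ⊔ a)
    FinitePartialSums≤1 = ∀ x {k} (f : Fin k → OutArc D x) → Injective _≡_ _≡_ f → sum (outWeight ∘ f) ≤ 1#

    substochastic⇒sums≤1 : IsSubstochastic W → FinitePartialSums≤1
    substochastic⇒sums≤1 sub x f f-injective with s , (sums≤s , _) , s≤1 ← sub x =
      ≤-trans (sums≤s (_ , f , f-injective , refl)) s≤1

    sums≤1⇒substochastic : FinitePartialSums≤1 → IsSubstochastic W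
    sums≤1⇒substochastic sums≤1 x = proj₁ sup , proj₂ sup , proj₂ (proj₂ sup) bound
      where
      bound : IsUpperBound _≤_ (PartialOutSum W x) 1#
      bound (_ , f , f-injective , s≈) = ≤-trans (≤-reflexive s≈) (sums≤1 x f f-injective)

      sup : Satisfiable (IsSupremum _≤_ (PartialOutSum W x))
      -- The empty sum 0 shows that there is a partial sum.
      sup = supremum (PartialOutSum W x) (0# , 0 , (λ ()) , (λ { {()} }) , refl) (1# , bound)

    module _ (sub : IsSubstochastic W) where

      outWeight≤1 : ∀ {x} (e : OutArc D x) → outWeight e ≤ 1#
      outWeight≤1 e = ≤-trans (≤-reflexive (sym (+-identityʳ _)))
        (substochastic⇒sums≤1 sub _ {1} (λ _ → e) (λ { {zero} {zero} _ → ≡.refl }))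

      outWeights≤1 : ∀ {x} {e e′ : OutArc D x} → e ≢ e′ → outWeight e + outWeight e′ ≤ 1#
      outWeights≤1 {e = e} {e′} e≢e′ = ≤-trans (+-monoʳ-≤ _ (≤-reflexive (sym (+-identityʳ _))))
        (substochastic⇒sums≤1 sub _ {2} pair pair-injective)
        where
        pair : Fin 2 → OutArc D _
        pair zero    = e
        pair (suc _) = e′

        pair-injective : Injective _≡_ _≡_ pair
        pair-injective {zero}     {zero}     _    = ≡.refl
        pair-injective {zero}     {suc zero} e≡e′ = contradiction e≡e′ e≢e′
        pair-injective {suc zero} {zero}     e′≡e = contradiction (≡.sym e′≡e) e≢e′
        pair-injective {suc zero} {suc zero} _    = ≡.refl

      Slack : V → Carrier → Set (v ⊔ a)
      Slack x δ = ∀ (e : OutArc D x) → outWeight e + δ ≤ 1#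

      -- Take the smaller weight of e and e′: every arc leaving x differs from e or from e′.
      branchSlack : ∀ {x} {e e′ : OutArc D x} → e ≢ e′ → ∃[ δ ] 0# < δ × Slack x δ
      branchSlack {x} {e} {e′} e≢e′ with total (outWeight e) (outWeight e′)
      ... | inj₁ w≤w′ = outWeight e , positive (proj₂ e) , slack
        where
        slack : Slack x (outWeight e)
        slack g with em {P = g ≡ e}
        ... | yes ≡.refl = ≤-trans (+-monoʳ-≤ _ w≤w′) (outWeights≤1 e≢e′)
        ... | no  g≢e    = outWeights≤1 g≢e
      ... | inj₂ w′≤w = outWeight e′ , positive (proj₂ e′) , slack
        where
        slack : Slack x (outWeight e′)
        slack g with em {P = g ≡ e′}
        ... | yes ≡.refl = ≤-trans (+-monoʳ-≤ _ w′≤w) (outWeights≤1 (e≢e′ ∘ ≡.sym))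
        ... | no  g≢e′   = outWeights≤1 g≢e′

      -- With w the weight of the arc that the cycle follows out of x, both w + δ ≤ 1 and, by
      -- Bernoulli, 1 ≤ w + ℓ (1 - r); cancel w. The bound δ depends on x only, not on the cycle.
      slack⇒lowerBound : (γ : Cycle D) → ∀ {x δ} → Slack x δ → Visits γ x →
                         ∀ {r} → IsSpectralRadius ℝ (cycleMatrix W γ) r → δ ≤ fromℕ (Cycle.length γ) * (1# - r)
      slack⇒lowerBound γ {δ = δ} slack (i , ≡.refl) {r} (eigenmodulus@(_ , _ , 0≤r , _) , _) =
        +-cancelʳ-≤ w (begin
          δ + w                                    ≈⟨ +-comm δ w ⟩
          w + δ                                    ≤⟨ slack (outArc γ i) ⟩
          1#                                       ≤⟨ bernoulli length 0≤r r≤1 ⟩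
          r ^ length + fromℕ length * (1# - r)     ≤⟨ +-monoˡ-≤ _ (modulus^length≤weight eigenmodulus weights≤1 i) ⟩
          w + fromℕ length * (1# - r)              ≈⟨ +-comm w _ ⟩
          fromℕ length * (1# - r) + w              ∎)
        where
        open Cycle γ using (length)
        open CycleMatrixProperties em ℝ W γ

        w : Carrier
        w = arcWeight i

        weights≤1 : ∀ j → arcWeight j ≤ 1#
        weights≤1 j = outWeight≤1 (outArc γ j)

        r≤1 : r ≤ 1#
        r≤1 = modulus≤weightBound eigenmodulus weights≤1

  -- A finite transversal makes the infimum positive

  module _ {v a} {V : Set v} (D : Digraph V a) (strong : IsStrong D) where
    open Branching em D strong

    transversal⇒positiveInfimum : HasFiniteCycleTransversal D → ((W , _) : 𝒮 ℝ D) → HasPositiveInfimum W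
    transversal⇒positiveInfimum (T , transversal) (W , sub) with em {P = ∃ Branch}
    -- There are no proper cycles, so the bound 1 holds vacuously.
    ... | no  none   = positiveInfimum (ProperCycleValue W) 0<1
      λ (γ , proper , _) → contradiction proper (nonbranching⇒¬proper (λ x branch → none (x , branch)) γ)
    ... | yes branch = positiveInfimum (ProperCycleValue W) 0<b λ { (γ , _ , _ , radius , ≡.refl) → b≤ γ radius }
      where
      open Extrema ≤-totalOrder

      forced : ∀ t → ∃[ u ] Star Forced t u × Branch u
      forced = forcedToBranch branch

      slack : ∀ t → ∃[ δ ] 0# < δ × Slack W sub (proj₁ (forced t)) δ
      slack t with _ , _ , _ , _ , e≢e′ ← forced t = branchSlack W sub e≢e′

      δ : V → Carrier
      δ = proj₁ ∘ slack

      b : Carrier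
      -- Finiteness of the transversal enters here: a minimum of finitely many positive slacks is
      -- positive. The default 1 covers an empty list.
      b = min 1# (map δ T)

      0<b : 0# < b
      0<b = v<min⁺ 0<1 (All.map⁺ (All.universal (proj₁ ∘ proj₂ ∘ slack) T))

      meets : (γ : Cycle D) → ∃[ i ] Cycle.vertex γ i ∈ T
      meets γ with em {P = ∃[ i ] Cycle.vertex γ i ∈ T}
      ... | yes found = found
      ... | no  none  = contradiction (restrict γ λ i v∈T → none (i , v∈T)) transversal

      b≤ : (γ : Cycle D) → ∀ {r} → IsSpectralRadius ℝ (cycleMatrix W γ) r → b ≤ fromℕ (Cycle.length γ) * (1# - r)
      b≤ γ radius with i , t∈T ← meets γ = ≤-trans
        (All.lookup (min≤xs 1# (map δ T)) (∈-map⁺ δ t∈T))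
        (slack⇒lowerBound W sub γ (proj₂ (proj₂ (slack t))) visits radius)
        where
        t : V
        t = Cycle.vertex γ i

        visits : Visits γ (proj₁ (forced t))
        visits = forced⇒visits γ (proj₁ (proj₂ (forced t))) (i , ≡.refl)

  -- Redistributing the out-weight of a vertex

  splitUnit : ∀ {y} → 0# < y → ∃[ r ] 0# < r × 0# < y * r × y * r + r ≈ 1#
  -- r is 1 / (y + 1). For y = `scale k` the two parts of 1 become `λ′ k` and `ε′ k`.
  splitUnit {y} 0<y with r , [y+1]r≈1 ← inverse {y + 1#} (proj₂ (+-pos-nonneg 0<y 0≤1) ∘ sym) =
    r , 0<r , *-pos 0<y 0<r , yr+r≈1
    where
    yr+r≈1 : y * r + r ≈ 1#
    yr+r≈1 = trans (+-congˡ (sym (*-identityˡ r))) (trans (sym (distribʳ r y 1#)) [y+1]r≈1)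

    0<r : 0# < r
    0<r = 0≤r (total 0# r) , λ 0≈r → 1≉0 (trans (sym [y+1]r≈1) (trans (*-congˡ (sym 0≈r)) (zeroʳ _)))
      where
      0≤r : 0# ≤ r ⊎ r ≤ 0# → 0# ≤ r
      0≤r (inj₁ 0≤r) = 0≤r
      0≤r (inj₂ r≤0) = contradiction (antisym 1≤0 0≤1) 1≉0
        where
        1≤0 : 1# ≤ 0#
        1≤0 = begin
          1#             ≈⟨ [y+1]r≈1 ⟨
          (y + 1#) * r   ≤⟨ *-monoʳ-≤ (proj₁ (+-pos-nonneg 0<y 0≤1)) r≤0 ⟩
          (y + 1#) * 0#  ≈⟨ zeroʳ _ ⟩
          0#             ∎

  module Biasing {v a} {V : Set v} {D : Digraph V a} (S : 𝒮 ℝ D) where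

    -- A recipe for new weights at x: `target` receives `kept` whatever its old weight, and every
    -- other outgoing arc has its old weight multiplied by `rest`.
    record Bias (x : V) : Set (v ⊔ a) where
      field
        target      : OutArc D x
        kept rest   : Carrier
        0<kept      : 0# < kept
        0<rest      : 0# < rest
        kept+rest≈1 : kept + rest ≈ 1#

    open Bias

    private
      W = proj₁ S
      w = outWeight W

    biasedWeight : ∀ {x} → Maybe (Bias x) → OutArc D x → Carrier
    biasedWeight nothing  e = w e
    biasedWeight (just β) e with em {P = e ≡ target β}
    ... | yes _ = kept β
    ... | no  _ = rest β * w e

    biasedWeight-target : ∀ {x} (β : Bias x) → biasedWeight (just β) (target β) ≡ kept β
    biasedWeight-target β with em {P = target β ≡ target β}
    ... | yes _ = ≡.refl
    ... | no ≢  = contradiction ≡.refl ≢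

    biasedWeight-other : ∀ {x} (β : Bias x) {e} → e ≢ target β → biasedWeight (just β) e ≡ rest β * w e
    biasedWeight-other β {e} e≢ with em {P = e ≡ target β}
    ... | yes e≡ = contradiction e≡ e≢
    ... | no  _  = ≡.refl

    biasedWeight-positive : ∀ {x} (β? : Maybe (Bias x)) e → 0# < biasedWeight β? e
    biasedWeight-positive nothing  e = Weighting.positive W (proj₂ e)
    biasedWeight-positive (just β) e with em {P = e ≡ target β}
    ... | yes _ = 0<kept β
    ... | no  _ = *-pos (0<rest β) (Weighting.positive W (proj₂ e))

    biasedSum-other : ∀ {x} (β : Bias x) {k} (f : Fin k → OutArc D x) → Injective _≡_ _≡_ f →
                      (∀ i → f i ≢ target β) → sum (biasedWeight (just β) ∘ f) ≤ rest β
    biasedSum-other β f f-injective f≢ = begin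
      sum (biasedWeight (just β) ∘ f)  ≈⟨ sum-cong-≋ (λ i → reflexive (biasedWeight-other β (f≢ i))) ⟩
      sum (λ i → rest β * w (f i))     ≈⟨ *-distribˡ-sum (rest β) (w ∘ f) ⟨
      rest β * sum (w ∘ f)             ≤⟨ *-monoʳ-≤ (proj₁ (0<rest β)) (substochastic⇒sums≤1 W (proj₂ S) _ f f-injective) ⟩
      rest β * 1#                      ≈⟨ *-identityʳ (rest β) ⟩
      rest β                           ∎

    -- By injectivity the target occurs at most once and contributes `kept`; the other terms are
    -- `rest` times an old partial sum, hence at most `rest`.
    biasedSum≤1 : ∀ {x} (β? : Maybe (Bias x)) {k} (f : Fin k → OutArc D x) → Injective _≡_ _≡_ f →
                  sum (biasedWeight β? ∘ f) ≤ 1#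
    biasedSum≤1 nothing  f f-injective = substochastic⇒sums≤1 W (proj₂ S) _ f f-injective
    biasedSum≤1 (just β) {k} f f-injective with em {P = ∃[ i ] f i ≡ target β}
    biasedSum≤1 (just β) {k}     f f-injective | no  none = begin
      sum (biasedWeight (just β) ∘ f)  ≤⟨ biasedSum-other β f f-injective (λ i fᵢ≡ → none (i , fᵢ≡)) ⟩
      rest β                           ≤⟨ x≤x+y (proj₁ (0<kept β)) ⟩
      rest β + kept β                  ≈⟨ +-comm (rest β) (kept β) ⟩
      kept β + rest β                  ≈⟨ kept+rest≈1 β ⟩
      1#                               ∎
    biasedSum≤1 (just β) {suc k} f f-injective | yes (i , fᵢ≡) = begin
      sum (biasedWeight (just β) ∘ f)
        ≈⟨ sum-remove {i = i} (biasedWeight (just β) ∘ f) ⟩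
      biasedWeight (just β) (f i) + sum (biasedWeight (just β) ∘ f ∘ punchIn i)
        ≈⟨ +-congʳ (reflexive (≡.trans (≡.cong (biasedWeight (just β)) fᵢ≡) (biasedWeight-target β))) ⟩
      kept β + sum (biasedWeight (just β) ∘ f ∘ punchIn i)
        ≤⟨ +-monoʳ-≤ (kept β) (biasedSum-other β (f ∘ punchIn i) (punchIn-injective i _ _ ∘ f-injective)
             (λ j f≡ → punchInᵢ≢i i j (f-injective (≡.trans f≡ (≡.sym fᵢ≡))))) ⟩
      kept β + rest β
        ≈⟨ kept+rest≈1 β ⟩
      1# ∎

    biased : (∀ x → Maybe (Bias x)) → 𝒮 ℝ D
    biased bias = Wᵝ , sums≤1⇒substochastic Wᵝ (λ x → biasedSum≤1 (bias x))
      where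
      Wᵝ : Weighting ℝ D
      Wᵝ = record
        { weight   = λ {x} {y} e → biasedWeight (bias x) (y , e)
        ; positive = λ {x} {y} e → biasedWeight-positive (bias x) (y , e)
        }

  -- Disjoint cycles and a weighting with infimum zero

  module _ {v a} {V : Set v} (D : Digraph V a) (S : 𝒮 ℝ D) (¬transversal : ¬ HasFiniteCycleTransversal D) where
    open Biasing S

    cycleAvoiding : ∀ (T : List V) → Cycle (D ∖ (_∈ T))
    cycleAvoiding T with em {P = Cycle (D ∖ (_∈ T))}
    ... | yes γ = γ
    ... | no ¬γ = contradiction (T , ¬γ) ¬transversal

    -- The vertices of the cycles chosen so far, kept as a list: being finite they are not a
    -- transversal, so a further cycle avoids them all.
    used : ℕ → List V
    used zero    = []
    used (suc k) = tabulate (Cycle.vertex (unrestrict (cycleAvoiding (used k)))) ++ used k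

    γ : ℕ → Cycle D
    γ k = unrestrict (cycleAvoiding (used k))

    module γ k = Cycle (γ k)

    used-mono : ∀ {j k x} → j ≤′ k → x ∈ used j → x ∈ used k
    used-mono ≤′-refl       x∈ = x∈
    used-mono (≤′-step j≤k) x∈ = ∈-++⁺ʳ _ (used-mono j≤k x∈)

    vertex≢earlier : ∀ {j k} → suc j ≤′ k → ∀ i i′ → γ.vertex j i ≢ γ.vertex k i′
    vertex≢earlier {j} {k} j<k i i′ eq = unrestrict-avoids (cycleAvoiding (used k)) i′
      (≡.subst (_∈ used k) eq (used-mono j<k (∈-++⁺ˡ (∈-tabulate⁺ {f = γ.vertex j} i))))

    γ-disjoint : ∀ {j k i i′} → γ.vertex j i ≡ γ.vertex k i′ → j ≡ k
    γ-disjoint {j} {k} eq with <-cmp j k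
    ... | tri< j<k _ _ = contradiction eq (vertex≢earlier (≤⇒≤′ j<k) _ _)
    ... | tri≈ _ j≡k _ = j≡k
    ... | tri> _ _ k<j = contradiction (≡.sym eq) (vertex≢earlier (≤⇒≤′ k<j) _ _)

    -- The arcs of `γ k` and one arc of the disjoint cycle `γ (suc k)` have distinct sources, which
    -- makes one arc more than the length.
    γ-proper : ∀ k → IsProper (γ k)
    γ-proper k = mk↣ {to = arcs} arcs-injective
      where
      other : Fin (γ.length (suc k))
      other = DirectedCycleProperties.base em (γ.isDirectedCycle (suc k))

      arcs : Fin (suc (γ.length k)) → Arc D
      arcs zero    = γ.vertex (suc k) other , outArc (γ (suc k)) other
      arcs (suc i) = γ.vertex k i , outArc (γ k) i

      arcs-injective : Injective _≡_ _≡_ arcs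
      arcs-injective {zero}  {zero}   eq = ≡.refl
      arcs-injective {zero}  {suc i′} eq = contradiction (γ-disjoint {suc k} {k} (≡.cong proj₁ eq)) 1+n≢n
      arcs-injective {suc i} {zero}   eq = contradiction (γ-disjoint {suc k} {k} (≡.cong proj₁ (≡.sym eq))) 1+n≢n
      arcs-injective {suc i} {suc i′} eq = ≡.cong suc (γ.vertex-injective k (≡.cong proj₁ eq))

    -- With scale k * ε′ k ≈ 1 − ε′ k, the value ℓ(γₖ) ε′ k is less than 1 / (k + 1).
    scale : ℕ → Carrier
    scale k = suc k · fromℕ (γ.length k)

    0<scale : ∀ k → 0# < scale k
    0<scale k = suc·-pos k (0<fromℕ (γ.nonEmpty k))
      where
      0<fromℕ : ∀ {n} → NonZero n → 0# < fromℕ n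
      0<fromℕ {suc n} _ = suc·-pos n 0<1

    ε′ λ′ : ℕ → Carrier
    ε′ k = proj₁ (splitUnit (0<scale k))
    λ′ k = scale k * ε′ k

    0<ε′ : ∀ k → 0# < ε′ k
    0<ε′ k = proj₁ (proj₂ (splitUnit (0<scale k)))

    0<λ′ : ∀ k → 0# < λ′ k
    0<λ′ k = proj₁ (proj₂ (proj₂ (splitUnit (0<scale k))))

    λ′+ε′≈1 : ∀ k → λ′ k + ε′ k ≈ 1#
    λ′+ε′≈1 k = proj₂ (proj₂ (proj₂ (splitUnit (0<scale k))))

    -- The decision is an argument so that `γ-weight` can analyse the same `em` term that `Sᵝ`
    -- passes in. Vertices on none of the chosen cycles keep their weights.
    biasAt : ∀ {x} → Dec (∃[ k ] Visits (γ k) x) → Maybe (Bias x)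
    biasAt (no _)                 = nothing
    biasAt (yes (k , i , ≡.refl)) = just record
      { target      = outArc (γ k) i
      ; kept        = λ′ k
      ; rest        = ε′ k
      ; 0<kept      = 0<λ′ k
      ; 0<rest      = 0<ε′ k
      ; kept+rest≈1 = λ′+ε′≈1 k
      }

    Sᵝ : 𝒮 ℝ D
    Sᵝ = biased λ x → biasAt (em {P = ∃[ k ] Visits (γ k) x})

    γ-weight : ∀ k i → biasedWeight (biasAt (em {P = ∃[ j ] Visits (γ j) (γ.vertex k i)})) (outArc (γ k) i) ≡ λ′ k
    γ-weight k i with em {P = ∃[ j ] Visits (γ j) (γ.vertex k i)}
    ... | no none = contradiction (k , i , ≡.refl) none
    ... | yes (j , i′ , eq)
      -- The visit returned by `em` may name another cycle or position. Disjointness identifies the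
      -- cycle, injectivity the position, and the remaining loop `eq` must be reflexivity for
      -- `biasAt` to reduce.
      with ≡.refl ← γ-disjoint {j} {k} eq
      with ≡.refl ← γ.vertex-injective k eq
      with ≡.refl ← eq
      = biasedWeight-target _

    γ-value : ∀ k → ProperCycleValue (proj₁ Sᵝ) [ fromℕ (γ.length k) * (1# - λ′ k) ]
    γ-value k = γ k , γ-proper k , λ′ k ,
      constantWeight⇒spectralRadius (λ i → reflexive (γ-weight k i)) , ≡.refl
      where open CycleMatrixProperties em ℝ (proj₁ Sᵝ) (γ k)

    -- A lower bound m satisfies (k + 1) m ≤ `scale k * ε′ k`, which is `λ′ k` and so at most 1, for
    -- every k. By the Archimedean property m ≤ 0.
    ¬positiveInfimum : ¬ HasPositiveInfimum (proj₁ Sᵝ)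
    -- The proper cycle `γ 0` has a finite value, so the infimum is not infinite.
    ¬positiveInfimum (⊤⁺    , (m≤ , _) , _)               = contradiction (m≤ (γ-value 0)) λ ()
    ¬positiveInfimum ([ m ] , (m≤ , _) , [ (0≤m , 0≉m) ]) = 0≉m (antisym 0≤m (archimedean m 1# multiple≤1))
      where
      multiple≤1 : ∀ n → n · m ≤ 1#
      multiple≤1 zero    = 0≤1
      multiple≤1 (suc k) = begin
        suc k · m                                     ≤⟨ ·-monoʳ-≤ (suc k) ([≤]-injective (m≤ (γ-value k))) ⟩
        suc k · (fromℕ (γ.length k) * (1# - λ′ k))    ≈⟨ ×-assoc-* (suc k) _ _ ⟨
        scale k * (1# - λ′ k)                         ≤⟨ *-monoʳ-≤ (proj₁ (0<scale k)) 1-λ′≤ε′ ⟩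
        λ′ k                                          ≤⟨ x≤x+y (proj₁ (0<ε′ k)) ⟩
        λ′ k + ε′ k                                   ≈⟨ λ′+ε′≈1 k ⟩
        1#                                            ∎
        where
        1-λ′≤ε′ : 1# - λ′ k ≤ ε′ k
        1-λ′≤ε′ = +-cancelʳ-≤ (λ′ k) (≤-reflexive
          (trans (x-y+y≈x (λ′ k) 1#) (trans (sym (λ′+ε′≈1 k)) (+-comm _ _))))

-- `S₀` is the weighting that the forward direction biases. If there were none, as when uncountably
-- many arcs leave some vertex, the left side would hold vacuously.
proposition1 : (∀ {ℓ} → ExcludedMiddle ℓ) →
    (ℝ : CompleteOrderedField) →
    ∀ {v a} {V : Set v} (D : Digraph V a) →
    IsStrong D →
    𝒮 ℝ D →
    (∀ (S : 𝒮 ℝ D) → HasPositiveInfimum (proj₁ S)) ⇔ HasFiniteCycleTransversal D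
proposition1 em ℝ D strong S₀ = mk⇔ forward (transversal⇒positiveInfimum em ℝ D strong)
  where
  forward : (∀ (S : 𝒮 ℝ D) → HasPositiveInfimum (proj₁ S)) → HasFiniteCycleTransversal D
  forward positive with em {P = HasFiniteCycleTransversal D}
  ... | yes transversal = transversal
  ... | no ¬transversal =
    contradiction (positive (Sᵝ em ℝ D S₀ ¬transversal)) (¬positiveInfimum em ℝ D S₀ ¬transversal)
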